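{- No algorithm can enumerate a minimum spanning tree of an edge-weighted, undirected, connected graph with at least two different edge weights, maximum degree $\Delta$ and average degree $\overline{\Delta}\in o(\Delta)$ with both preprocessing and delay in $o(\Delta)$.
   Context: Graphs $G=(V,E)$ have vertex set $V=\{1,\dots,n\}$, $m=|E|$ edges and edge weights $w\colon E\to\mathbb{R}$. $\Delta$ is the maximum degree and $\overline{\Delta}=\frac1n\sum_{v\in V}\deg(v)$ the average degree. A spanning tree of $G$ is a connected acyclic subgraph $T=(V,E')$ with $E'\subseteq E$; a minimum spanning tree is a spanning tree minimizing $\sum_{e\in E'}w(e)$. Model: word RAM with word size in $\Omega(\log n)$. The graph is given by adjacency lists, with edge weights stored alongside the list entries. The algorithm accesses the input by queries, each taking constant time: a degree query for a vertex $v$ returns the degree of $v$; a neighbor query for $v$ returns the next, not yet returned entry of the adjacency list of $v$ together with the edge weight. The order of the entries in the lists is arbitrary. Enumeration: given the whole input graph, an enumeration algorithm must, for some single minimum spanning tree $T$ of the graph, emit each edge of $T$ exactly once (irrevocably). Its delay is the worst-case maximum time the algorithm needs to emit the respective next edge; preprocessing time is additional time spent before emitting the first edge (so the first edge is emitted within the sum of the preprocessing and delay bounds). The lower bound is on worst-case complexity over all such inputs. -}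

module Defs where

open import Data.Bool using (Bool; true; false; if_then_else_)
open import Data.Fin using (Fin; toℕ; fromℕ<)
open import Data.Integer using (+_)
open import Data.List using (List; []; _∷_; _++_; length; map; foldr; sum; allFin; [_])
open import Data.List.Extrema.Nat using (max)
open import Data.List.Membership.Propositional using (_∈_; _∉_)
open import Data.List.Relation.Unary.All using (All)
open import Data.List.Relation.Unary.AllPairs using (AllPairs)
open import Data.List.Relation.Unary.Linked using (Linked)
open import Data.List.Relation.Unary.Unique.Propositional using (Unique)
open import Data.Maybe using (Maybe; just; nothing)
open import Data.Nat as ℕ using (ℕ; zero; suc; NonZero)
open import Data.Nat.DivMod using (_mod_)
open import Data.Nat.Logarithm using (⌈log₂_⌉)
import Data.Nat.Properties as ℕ
open import Data.Product using (Σ; ∃; ∃₂; _×_; _,_; proj₁; proj₂)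
open import Data.Rational as ℚ using (ℚ; 0ℚ; 1ℚ; ½; ∣_∣)
import Data.Rational.Properties as ℚ
open import Data.Rational.Solver using (module +-*-Solver)
open import Data.Sum using (_⊎_)
open import Relation.Binary.Construct.Closure.ReflexiveTransitive using (Star)
open import Relation.Binary.PropositionalEquality using (_≡_; refl; sym; subst; cong)
open import Relation.Nullary using (¬_; yes; no; ⌊_⌋)

------------------------------------------------------------------------
-- Real numbers: Cauchy sequences of rationals, with the usual equality
-- and order (not propositional equality of representations).

record ℝ : Set where
  constructor mkℝ
  field
    approx : ℕ → ℚ
    cauchy : ∀ ε → 0ℚ ℚ.< ε → ∃ λ N → ∀ i j → N ℕ.≤ i → N ℕ.≤ j →
             ∣ approx i ℚ.- approx j ∣ ℚ.≤ ε

open ℝ public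

fromℚ : ℚ → ℝ
fromℚ q .approx _ = q
fromℚ q .cauchy ε 0<ε = 0 , λ _ _ _ _ →
  subst (ℚ._≤ ε) (sym (cong ∣_∣ (ℚ.+-inverseʳ q))) (ℚ.<⇒≤ 0<ε)

0ℝ : ℝ
0ℝ = fromℚ 0ℚ

infixl 6 _+ℝ_
_+ℝ_ : ℝ → ℝ → ℝ
(x +ℝ y) .approx i = approx x i ℚ.+ approx y i
(x +ℝ y) .cauchy ε 0<ε = N₁ ℕ.⊔ N₂ , bound
  where
  open ℚ.≤-Reasoning
  0<ε/2 : 0ℚ ℚ.< ½ ℚ.* ε
  0<ε/2 = subst (ℚ._< ½ ℚ.* ε) (ℚ.*-zeroʳ ½) (ℚ.*-monoʳ-<-pos ½ 0<ε)
  N₁ N₂ : ℕ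
  N₁ = proj₁ (cauchy x (½ ℚ.* ε) 0<ε/2)
  N₂ = proj₁ (cauchy y (½ ℚ.* ε) 0<ε/2)
  rearrange : ∀ a b c d → (a ℚ.+ b) ℚ.- (c ℚ.+ d) ≡ (a ℚ.- c) ℚ.+ (b ℚ.- d)
  rearrange = solve 4 (λ a b c d → (a :+ b) :- (c :+ d) := (a :- c) :+ (b :- d)) refl
    where open +-*-Solver
  halves : ½ ℚ.* ε ℚ.+ ½ ℚ.* ε ≡ ε
  halves = begin-equality
    ½ ℚ.* ε ℚ.+ ½ ℚ.* ε  ≡⟨ sym (ℚ.*-distribʳ-+ ε ½ ½) ⟩
    1ℚ ℚ.* ε             ≡⟨ ℚ.*-identityˡ ε ⟩
    ε                    ∎
  bound : ∀ i j → N₁ ℕ.⊔ N₂ ℕ.≤ i → N₁ ℕ.⊔ N₂ ℕ.≤ j →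
          ∣ (approx x i ℚ.+ approx y i) ℚ.- (approx x j ℚ.+ approx y j) ∣ ℚ.≤ ε
  bound i j N≤i N≤j = begin
    ∣ (approx x i ℚ.+ approx y i) ℚ.- (approx x j ℚ.+ approx y j) ∣
      ≡⟨ cong ∣_∣ (rearrange (approx x i) (approx y i) (approx x j) (approx y j)) ⟩
    ∣ (approx x i ℚ.- approx x j) ℚ.+ (approx y i ℚ.- approx y j) ∣
      ≤⟨ ℚ.∣p+q∣≤∣p∣+∣q∣ (approx x i ℚ.- approx x j) (approx y i ℚ.- approx y j) ⟩
    ∣ approx x i ℚ.- approx x j ∣ ℚ.+ ∣ approx y i ℚ.- approx y j ∣
      ≤⟨ ℚ.+-mono-≤
           (proj₂ (cauchy x (½ ℚ.* ε) 0<ε/2) i j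
              (ℕ.m⊔n≤o⇒m≤o N₁ N₂ N≤i) (ℕ.m⊔n≤o⇒m≤o N₁ N₂ N≤j))
           (proj₂ (cauchy y (½ ℚ.* ε) 0<ε/2) i j
              (ℕ.m⊔n≤o⇒n≤o N₁ N₂ N≤i) (ℕ.m⊔n≤o⇒n≤o N₁ N₂ N≤j)) ⟩
    ½ ℚ.* ε ℚ.+ ½ ℚ.* ε
      ≡⟨ halves ⟩
    ε ∎

infix 4 _≤ℝ_ _≈ℝ_
_≤ℝ_ : ℝ → ℝ → Set
x ≤ℝ y = ∀ ε → 0ℚ ℚ.< ε → ∃ λ N → ∀ i → N ℕ.≤ i → approx x i ℚ.≤ approx y i ℚ.+ ε

_≈ℝ_ : ℝ → ℝ → Set
x ≈ℝ y = x ≤ℝ y × y ≤ℝ x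

------------------------------------------------------------------------
-- Simple edge-weighted graphs given by adjacency lists.  Two vertices are
-- adjacent when one occurs in the list of the other; the lists are in
-- arbitrary order.  `weight u v` matters only for adjacent u and v.

record Graph : Set where
  field
    n           : ℕ
    {{n-nonZero}} : NonZero n
    adj         : Fin n → List (Fin n)
    adj-unique  : ∀ v → Unique (adj v)
    adj-irrefl  : ∀ v → v ∉ adj v
    adj-sym     : ∀ u v → v ∈ adj u → u ∈ adj v
    weight      : Fin n → Fin n → ℝ
    weight-sym  : ∀ u v → v ∈ adj u → weight u v ≡ weight v u

ℕ→ℚ : ℕ → ℚ
ℕ→ℚ k = + k ℚ./ 1

module _ (G : Graph) where
  open Graph G

  Vertex : Set
  Vertex = Fin n

  Adjacent : Vertex → Vertex → Set
  Adjacent u v = v ∈ adj u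

  deg : Vertex → ℕ
  deg v = length (adj v)

  maxDegree : ℕ
  maxDegree = max 0 (map deg (allFin n))

  avgDegree : ℚ
  avgDegree = + sum (map deg (allFin n)) ℚ./ n

  Connected : Set
  Connected = ∀ u v → Star Adjacent u v

  TwoWeights : Set
  TwoWeights = ∃₂ λ u v → ∃₂ λ x y →
    Adjacent u v × Adjacent x y × ¬ (weight u v ≈ℝ weight x y)

  -- A pair stands for the undirected edge between its components.
  Edge : Set
  Edge = Vertex × Vertex

  SameEdge : Edge → Edge → Set
  SameEdge (u , v) (x , y) = (u ≡ x × v ≡ y) ⊎ (u ≡ y × v ≡ x)

  -- Finite edge sets E′ ⊆ E, as lists without repetition (in either
  -- orientation).
  IsEdgeSet : List Edge → Set
  IsEdgeSet es = All (λ e → Adjacent (proj₁ e) (proj₂ e)) es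
               × AllPairs (λ e f → ¬ SameEdge e f) es

  Joined : List Edge → Vertex → Vertex → Set
  Joined es u v = (u , v) ∈ es ⊎ (v , u) ∈ es

  -- A cycle is v₀ – v₁ – … – vₖ – v₀ with distinct vertices and k ≥ 2.
  IsCycle : List Edge → Vertex → List Vertex → Set
  IsCycle es v₀ vs = 2 ℕ.≤ length vs
                   × Unique (v₀ ∷ vs)
                   × Linked (Joined es) (v₀ ∷ vs ++ [ v₀ ])

  record IsSpanningTree (es : List Edge) : Set where
    field
      isEdgeSet : IsEdgeSet es
      connected : ∀ u v → Star (Joined es) u v
      acyclic   : ∀ v₀ vs → ¬ IsCycle es v₀ vs

  totalWeight : List Edge → ℝ
  totalWeight = foldr (λ e s → weight (proj₁ e) (proj₂ e) +ℝ s) 0ℝ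

  IsMST : List Edge → Set
  IsMST es = IsSpanningTree es
           × (∀ es′ → IsSpanningTree es′ → totalWeight es ≤ℝ totalWeight es′)

------------------------------------------------------------------------
-- The word RAM.

Word : ℕ → Set
Word w = Fin (2 ℕ.^ w)

-- The unit-cost operations are a parameter, as the literature varies in
-- which arithmetic and bitwise operations it admits.  Weights are real
-- numbers, kept in cells of their own, and are accessible to the program
-- only through weightOp (e.g. addition) and weightTest (e.g. comparison).
-- An arbitrary Bool-valued function may be supplied as a test: although
-- comparison of reals is not computable, it is a legitimate (classical)
-- choice here.
record InstructionSet : Set₁ where
  field
    WordOp WeightOp WeightTest : Set
    wordOp     : WordOp → (w : ℕ) → Word w → Word w → Word w
    weightOp   : WeightOp → ℝ → ℝ → ℝ
    weightTest : WeightTest → ℝ → ℝ → Bool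

Cell : Set
Cell = ℕ

module _ (I : InstructionSet) where
  open InstructionSet I

  -- Operands of type `List Cell` hold one number, written in base 2 ^ w
  -- with the least significant word first.  With a word size in Ω(log n)
  -- a vertex may need more than one word, but constantly many suffice.
  data Instr : Set where
    const   : (dst : Cell) (k : ℕ) → Instr
    apply   : WordOp → (dst a b : Cell) → Instr
    load    : (dst : Cell) (address : List Cell) → Instr
    store   : (address : List Cell) (src : Cell) → Instr
    applyW  : WeightOp → (dst a b : Cell) → Instr
    testW   : WeightTest → (dst a b : Cell) → Instr
    loadW   : (dst : Cell) (address : List Cell) → Instr
    storeW  : (address : List Cell) (src : Cell) → Instr
    branch  : (cond : Cell) (target : ℕ) → Instr
    order   : (dst : List Cell) → Instr
    degreeQuery   : (v dst : List Cell) → Instr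
    neighborQuery : (v dst : List Cell) (dstW : Cell) → Instr
    emit    : (u v : List Cell) → Instr

  -- Execution halts when the program counter leaves the program.
  Program : Set
  Program = List Instr

fetch : {A : Set} → List A → ℕ → Maybe A
fetch []       _       = nothing
fetch (x ∷ _)  zero    = just x
fetch (_ ∷ xs) (suc i) = fetch xs i

update : {A : Set} → Cell → A → (Cell → A) → (Cell → A)
update c x f d = if ⌊ c ℕ.≟ d ⌋ then x else f d

base-nonZero : ∀ w → NonZero (2 ℕ.^ w)
base-nonZero w = ℕ.m^n≢0 2 w

toWord : (w : ℕ) → ℕ → Word w
toWord w k = _mod_ k (2 ℕ.^ w) {{base-nonZero w}}

highPart : (w : ℕ) → ℕ → ℕ
highPart w k = ℕ._/_ k (2 ℕ.^ w) {{base-nonZero w}}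

module _ (w : ℕ) where

  readNumber : (Cell → Word w) → List Cell → ℕ
  readNumber mem []       = 0
  readNumber mem (c ∷ cs) = toℕ (mem c) ℕ.+ 2 ℕ.^ w ℕ.* readNumber mem cs

  writeNumber : List Cell → ℕ → (Cell → Word w) → (Cell → Word w)
  writeNumber []       k mem = mem
  writeNumber (c ∷ cs) k mem = writeNumber cs (highPart w k) (update c (toWord w k) mem)

-- Runs on the input G with word size w.

module Execution (I : InstructionSet) (w : ℕ) (G : Graph) where
  open InstructionSet I
  open Graph G

  record State : Set where
    field
      pc       : ℕ
      mem      : Cell → Word w
      memW     : Cell → ℝ
      returned : Vertex G → ℕ       -- list entries returned so far
      output   : List (Edge G)      -- in the order of emission

  open State

  initial : State
  initial .pc             = 0
  initial .mem _          = toWord w 0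
  initial .memW _         = 0ℝ
  initial .returned _     = 0
  initial .output         = []

  readVertex : (Cell → Word w) → List Cell → Maybe (Vertex G)
  readVertex m cs with readNumber w m cs ℕ.<? n
  ... | yes v<n = just (fromℕ< v<n)
  ... | no  _   = nothing

  advance : Vertex G → (Vertex G → ℕ) → (Vertex G → ℕ)
  advance v f u = if ⌊ toℕ v ℕ.≟ toℕ u ⌋ then suc (f u) else f u

  isZero : Word w → Bool
  isZero x = ⌊ toℕ x ℕ.≟ 0 ⌋

  next : State → State
  next s = record s { pc = suc (pc s) }

  -- Queries and emissions with an operand that is not a vertex, and
  -- neighbor queries to an exhausted list, have no effect.
  execute : Instr I → State → State
  execute (const d k)      s = next record s { mem = update d (toWord w k) (mem s) }
  execute (apply o d a b)  s =
    next record s { mem = update d (wordOp o w (mem s a) (mem s b)) (mem s) }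
  execute (load d as)      s =
    next record s { mem = update d (mem s (readNumber w (mem s) as)) (mem s) }
  execute (store as a)     s =
    next record s { mem = update (readNumber w (mem s) as) (mem s a) (mem s) }
  execute (applyW o d a b) s =
    next record s { memW = update d (weightOp o (memW s a) (memW s b)) (memW s) }
  execute (testW o d a b)  s = next record s
    { mem = update d (toWord w (if weightTest o (memW s a) (memW s b) then 1 else 0)) (mem s) }
  execute (loadW d as)     s =
    next record s { memW = update d (memW s (readNumber w (mem s) as)) (memW s) }
  execute (storeW as a)    s =
    next record s { memW = update (readNumber w (mem s) as) (memW s a) (memW s) }
  execute (branch c l)     s =
    if isZero (mem s c) then next s else record s { pc = l }
  execute (order ds)       s = next record s { mem = writeNumber w ds n (mem s) }
  execute (degreeQuery vs ds) s with readVertex (mem s) vs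
  ... | nothing = next s
  ... | just v  = next record s { mem = writeNumber w ds (deg G v) (mem s) }
  execute (neighborQuery vs ds d) s with readVertex (mem s) vs
  ... | nothing = next s
  ... | just v with fetch (adj v) (returned s v)
  ...   | nothing = next s
  ...   | just u  = next record s
    { mem      = writeNumber w ds (toℕ u) (mem s)
    ; memW     = update d (weight v u) (memW s)
    ; returned = advance v (returned s)
    }
  execute (emit us vs) s with readVertex (mem s) us | readVertex (mem s) vs
  ... | just u | just v = next record s { output = output s ++ [ (u , v) ] }
  ... | _      | _      = next s

  step : Program I → State → State
  step P s with fetch P (pc s)
  ... | nothing = s
  ... | just i  = execute i s

  stateAt : Program I → ℕ → State
  stateAt P zero    = initial
  stateAt P (suc t) = step P (stateAt P t)

  outputAt : Program I → ℕ → List (Edge G)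
  outputAt P t = output (stateAt P t)

  -- `tree` lists the edges of a single MST in the order of their emission.
  record Enumerates (P : Program I) (preprocessing delay : ℕ) : Set where
    field
      tree      : List (Edge G)
      isMST     : IsMST G tree
      emitsTree : ∀ t → ∃ λ rest → outputAt P t ++ rest ≡ tree
      firstEdge : 0 ℕ.< length tree →
                  0 ℕ.< length (outputAt P (preprocessing ℕ.+ delay))
      nextEdge  : ∀ t → 0 ℕ.< length (outputAt P t) →
                  length (outputAt P t) ℕ.< length tree →
                  length (outputAt P t) ℕ.< length (outputAt P (t ℕ.+ delay))

open Execution public using (Enumerates)

------------------------------------------------------------------------
-- Asymptotics.

-- f ∈ o(Δ), as Δ → ∞, for quantities f and Δ depending on objects in A.
LittleO : {A : Set} → (A → ℚ) → (A → ℕ) → Set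
LittleO {A} f Δ = ∀ ε → 0ℚ ℚ.< ε →
  ∃ λ N → ∀ a → N ℕ.≤ Δ a → ∣ f a ∣ ℚ.≤ ε ℚ.* ℕ→ℚ (Δ a)

-- W ∈ Ω(log n).
OmegaLog : (ℕ → ℕ) → Set
OmegaLog W = ∃₂ λ k N → ∀ n → N ℕ.≤ n → ⌈log₂ n ⌉ ℕ.≤ k ℕ.* W n

Eventually≥ : ℚ → (ℕ → ℚ) → Set
Eventually≥ c g = ∃ λ N → ∀ Δ → N ℕ.≤ Δ → c ℚ.≤ g Δ

-- The inputs whose average degree is bounded by the function g of their
-- maximum degree.
record Input (g : ℕ → ℚ) : Set where
  field
    graph      : Graph
    connected  : Connected graph
    twoWeights : TwoWeights graph
    sparse     : avgDegree graph ℚ.≤ g (maxDegree graph)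

Δ[_] : ∀ {g} → Input g → ℕ
Δ[ x ] = maxDegree (Input.graph x)

-- Both bounds may depend on the whole input.  W gives the word size in
-- terms of the number of vertices.
EnumeratesInLittleOΔ : (I : InstructionSet) (W : ℕ → ℕ) (g : ℕ → ℚ) → Program I → Set
EnumeratesInLittleOΔ I W g P =
  Σ (Input g → ℕ) λ preprocessing → Σ (Input g → ℕ) λ delay →
    LittleO (λ x → ℕ→ℚ (preprocessing x)) Δ[_]
  × LittleO (λ x → ℕ→ℚ (delay x)) Δ[_]
  × (∀ x → let G = Input.graph x in
           Enumerates I (W (Graph.n G)) G P (preprocessing x) (delay x))

{-# OPTIONS --safe #-}

-- An adversary with k² vertices, arranged in k blocks of k.  Every vertex that the algorithm accesses
-- (a probed vertex) reports degree k, and its list starts with the k − 1 others of its block, at weight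
-- 1.  In t < k / 2 steps at most 2t < k vertices are accessed, so some block, the hub, stays untouched.
-- Hidden at the ends of the lists is a spanning tree of weight 0: each vertex outside the hub is joined
-- to the hub vertex in its position, and the hub is a star.  No tree edge joins two probed vertices, so
-- every edge emitted by then has weight 1 (or is no edge at all) and lies in no minimum spanning tree.
-- All other edges have a probed end, so the average degree is at most 4, while the maximum degree is
-- between k and 3k.

module Submission where

open import Defs
open import Data.Bool using (true; false; if_then_else_)
open import Data.Fin using (Fin; zero; suc; toℕ; fromℕ<; combine; quotient; remainder)
open import Data.Fin.Properties using (injective⇒≤; combine-remQuot; remQuot-combine; ¬∀⟶∃¬) renaming (_≟_ to _≟F_)
import Data.Integer as ℤ
import Data.Integer.Properties as ℤ
open import Data.List using (List; []; _∷_; _++_; [_]; length; map; filter; allFin; lookup; concatMap; cartesianProductWith; fromMaybe)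
open import Data.List.Extrema.Nat using (max≤v⁺; xs≤max)
import Data.List.Membership.DecPropositional as DecMembership
open import Data.List.Membership.Propositional using (_∈_; _∉_)
open import Data.List.Membership.Propositional.Properties using (∈-lookup; ∈-allFin; ∈-filter⁺; ∈-filter⁻; ∈-map⁺; ∈-map⁻; ∈-++⁺ˡ; ∈-++⁺ʳ; ∈-++⁻; ∈-cartesianProductWith⁺)
open import Data.List.Membership.Setoid.Properties using (index-injective)
open import Data.List.Properties using (length-map; length-++; length-tabulate; filter-≐; ++-identityʳ)
open import Data.List.Relation.Binary.Subset.Propositional using (_⊆_)
open import Data.List.Relation.Unary.All as All using (All; []; _∷_)
import Data.List.Relation.Unary.All.Properties as All
open import Data.List.Relation.Unary.AllPairs as AllPairs using (AllPairs; []; _∷_)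
import Data.List.Relation.Unary.AllPairs.Properties as AllPairs
open import Data.List.Relation.Unary.Any using (here; there)
open import Data.List.Relation.Unary.Linked using (Linked; _∷_)
open import Data.List.Relation.Unary.Unique.Propositional using (Unique)
import Data.List.Relation.Unary.Unique.Propositional.Properties as Unique
open import Data.Maybe using (Maybe; just; nothing)
open import Data.Nat using (ℕ; zero; suc; _+_; _*_; _≤_; _<_; z≤n; s≤s; NonZero; _<?_; _≟_)
open import Data.Nat.Induction using (Acc; acc; <-wellFounded)
open import Data.Nat.ListAction using (sum)
open import Data.Nat.Properties hiding (_≟_; _<?_)
open import Data.Product using (∃; _×_; _,_; proj₁; proj₂)
open import Data.Product.Properties using (,-injectiveʳ)
open import Data.Rational as ℚ using (ℚ; 0ℚ; 1ℚ; ½)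
import Data.Rational.Properties as ℚ
import Data.Rational.Unnormalised as ℚᵘ
import Data.Rational.Unnormalised.Properties as ℚᵘ
open import Data.Sum as Sum using (_⊎_; inj₁; inj₂; swap)
open import Function using (id; _∘_)
open import Relation.Binary.Construct.Closure.ReflexiveTransitive as Star using (Star; ε; _◅_; _◅◅_)
open import Relation.Binary.PropositionalEquality using (_≡_; _≢_; refl; sym; trans; cong; cong₂; subst; setoid; ≢-sym; module ≡-Reasoning)
open import Relation.Nullary using (¬_; Dec; does; yes; no; contradiction)
open import Relation.Nullary.Decidable using (¬?; _×-dec_; _⊎-dec_; dec-true; dec-false; from-no; toSum)

-- Counting with duplicate-free lists.

lookup-injective : {A : Set} {xs : List A} → Unique xs → ∀ i j → lookup xs i ≡ lookup xs j → i ≡ j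
lookup-injective (x≢ ∷ u) zero    zero    eq = refl
lookup-injective (x≢ ∷ u) zero    (suc j) eq = contradiction eq (All.lookup x≢ (∈-lookup j))
lookup-injective (x≢ ∷ u) (suc i) zero    eq = contradiction (sym eq) (All.lookup x≢ (∈-lookup i))
lookup-injective (x≢ ∷ u) (suc i) (suc j) eq = cong suc (lookup-injective u i j eq)

-- Sending an index of `xs` to the place of its entry in `ys` is injective. The degree bounds below
-- rest on this: a list of neighbours or of arcs is covered by a list of known length.
unique-⊆⇒length≤ : {A : Set} {xs ys : List A} → Unique xs → xs ⊆ ys → length xs ≤ length ys
unique-⊆⇒length≤ {A} u xs⊆ys = injective⇒≤ λ {i} {j} eq →
  lookup-injective u i j (index-injective (setoid A) (xs⊆ys (∈-lookup i)) (xs⊆ys (∈-lookup j)) eq)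

length-cartesianProductWith : {A B C : Set} (f : A → B → C) (xs : List A) (ys : List B) →
  length (cartesianProductWith f xs ys) ≡ length xs * length ys
length-cartesianProductWith f []       ys = refl
length-cartesianProductWith f (x ∷ xs) ys = trans (length-++ (map (f x) ys))
  (cong₂ _+_ (length-map (f x) ys) (length-cartesianProductWith f xs ys))

module _ {A B : Set} (f : A → List B) where

  -- For adjacency lists these are the edges in both directions, so that their number is the degree
  -- sum.
  arcs : List A → List (A × B)
  arcs = concatMap λ x → map (x ,_) (f x)

  length-arcs : ∀ xs → length (arcs xs) ≡ sum (map (length ∘ f) xs)
  length-arcs []       = refl
  length-arcs (x ∷ xs) = trans (length-++ (map (x ,_) (f x)))
    (cong₂ _+_ (length-map (x ,_) (f x)) (length-arcs xs))

  ∈-arcs⁻ : ∀ xs {x y} → (x , y) ∈ arcs xs → x ∈ xs × y ∈ f x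
  ∈-arcs⁻ (x ∷ xs) p with ∈-++⁻ (map (x ,_) (f x)) p
  ... | inj₂ q = let x∈ , y∈ = ∈-arcs⁻ xs q in there x∈ , y∈
  ... | inj₁ q with ∈-map⁻ (x ,_) q
  ...   | _ , y∈ , refl = here refl , y∈

  arcs-unique : (∀ x → Unique (f x)) → ∀ {xs} → Unique xs → Unique (arcs xs)
  arcs-unique uf []                  = []
  arcs-unique uf {x ∷ xs} (x≢ ∷ u) = Unique.++⁺ (Unique.map⁺ ,-injectiveʳ (uf x)) (arcs-unique uf u) disjoint
    where
    disjoint : ∀ {e} → e ∈ map (x ,_) (f x) × e ∈ arcs xs → _
    disjoint (p , q) with ∈-map⁻ (x ,_) p
    ... | _ , _ , refl = All.lookup x≢ (proj₁ (∈-arcs⁻ xs q)) refl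

-- Spanning trees given by a parent function.

module RootedTree (G : Graph) (root : Vertex G) (parent : Vertex G → Vertex G) (rank : Vertex G → ℕ)
  (rank-parent : ∀ {v} → v ≢ parent v → rank (parent v) < rank v)
  (fixed⇒root : ∀ {v} → v ≡ parent v → v ≡ root)
  (adjacent : ∀ {v} → v ≢ parent v → Adjacent G v (parent v)) where

  moves? : (v : Vertex G) → Dec (v ≢ parent v)
  moves? v = ¬? (v ≟F parent v)

  vertices : List (Vertex G)
  vertices = allFin (Graph.n G)

  edges : List (Edge G)
  edges = map (λ v → v , parent v) (filter moves? vertices)

  ∈-edges⁻ : ∀ {u v} → (u , v) ∈ edges → v ≡ parent u × rank v < rank u
  ∈-edges⁻ p with ∈-map⁻ _ p
  ... | w , w∈ , refl = refl , rank-parent (proj₂ (∈-filter⁻ moves? {xs = vertices} w∈))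

  ∈-edges⁺ : ∀ {v} → v ≢ parent v → (v , parent v) ∈ edges
  ∈-edges⁺ {v} v≢ = ∈-map⁺ (λ v → v , parent v)
    (∈-filter⁺ moves? (∈-allFin v) v≢)

  Up : Vertex G → Vertex G → Set
  Up u v = v ≡ parent u × rank v < rank u

  up-or-down : ∀ {u v} → Joined G edges u v → Up u v ⊎ Up v u
  up-or-down (inj₁ p) = inj₁ (∈-edges⁻ p)
  up-or-down (inj₂ p) = inj₂ (∈-edges⁻ p)

  isEdgeSet : IsEdgeSet G edges
  isEdgeSet = All.map⁺ (All.map adjacent (All.all-filter moves? vertices))
            , AllPairs.map⁺ (AllPairs.zipWith distinct (inEdges , Unique.filter⁺ moves? (Unique.allFin⁺ _)))
    where
    allPairs : ∀ {us} → All (λ v → v ≢ parent v) us → AllPairs (λ u v → u ≢ parent u × v ≢ parent v) us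
    allPairs []       = []
    allPairs (p ∷ ps) = All.map (p ,_) ps ∷ allPairs ps
    inEdges : AllPairs (λ u v → u ≢ parent u × v ≢ parent v) (filter moves? vertices)
    inEdges = allPairs (All.all-filter moves? vertices)
    distinct : ∀ {u v} → (u ≢ parent u × v ≢ parent v) × u ≢ v → ¬ SameEdge G (u , parent u) (v , parent v)
    distinct (_ , u≢v)         (inj₁ (u≡v , _))     = u≢v u≡v
    -- Opposite orientations of one edge would make each end the parent of the other, although the
    -- rank falls strictly towards a parent.
    distinct ((u≢ , v≢) , _) (inj₂ (u≡ , pu≡v)) =
      <-asym (subst (λ x → rank x < _) pu≡v (rank-parent u≢)) (subst (λ x → rank x < _) (sym u≡) (rank-parent v≢))

  connected : ∀ u v → Star (Joined G edges) u v
  connected u v = toRoot u (<-wellFounded _) ◅◅ Star.reverse swapped (toRoot v (<-wellFounded _))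
    where
    swapped : ∀ {x y} → Joined G edges x y → Joined G edges y x
    swapped (inj₁ p) = inj₂ p
    swapped (inj₂ p) = inj₁ p
    -- Passing to parents lowers the rank, so it stops, and it can stop only at a fixed point of
    -- `parent`.
    toRoot : ∀ w → Acc _<_ (rank w) → Star (Joined G edges) w root
    toRoot w (acc rec) with w ≟F parent w
    ... | yes w≡ = subst (Star _ w) (fixed⇒root w≡) ε
    ... | no  w≢ = inj₁ (∈-edges⁺ w≢) ◅ toRoot (parent w) (rec (rank-parent w≢))

  -- A walk without immediate returns never goes up again after its first step down.
  descend : ∀ {a b z} l → Unique (a ∷ b ∷ l) → z ∉ b ∷ l → (l ≡ [] → a ≢ z) →
            Linked (Joined G edges) (a ∷ b ∷ l ++ [ z ]) → Up b a →
            rank a < rank z × parent z ∈ b ∷ l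
  descend [] _ _ a≢z (_ ∷ bz ∷ _) (a≡pb , a<b) with up-or-down bz
  ... | inj₁ (z≡pb , _)   = contradiction (trans a≡pb (sym z≡pb)) (a≢z refl)
  ... | inj₂ (b≡pz , b<z) = <-trans a<b b<z , here (sym b≡pz)
  descend (c ∷ l) ((_ ∷ a≢c ∷ _) ∷ u) z∉ _ (_ ∷ bc∷) (a≡pb , a<b) with bc∷
  ... | bc ∷ _ with up-or-down bc
  ...   | inj₁ (c≡pb , _) = contradiction (trans a≡pb (sym c≡pb)) a≢c
  ...   | inj₂ down       =
    let b<z , pz∈ = descend l u (z∉ ∘ there) (λ _ b≡z → z∉ (here (sym b≡z))) bc∷ down
    in <-trans a<b b<z , there pz∈

  -- While the walk climbs, the rank falls. Once it turns down it keeps going down, and it reaches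
  -- `z` from the parent of `z`.
  ascend : ∀ {a b z} l → Unique (a ∷ b ∷ l) → z ∉ b ∷ l →
           Linked (Joined G edges) (a ∷ b ∷ l ++ [ z ]) → Up a b →
           rank z < rank a ⊎ parent z ∈ b ∷ l
  ascend [] _ _ (_ ∷ bz ∷ _) (_ , b<a) with up-or-down bz
  ... | inj₁ (_ , z<b)  = inj₁ (<-trans z<b b<a)
  ... | inj₂ (b≡pz , _) = inj₂ (here (sym b≡pz))
  ascend (c ∷ l) (_ ∷ u) z∉ (_ ∷ bc∷) (_ , b<a) with bc∷
  ... | bc ∷ _ with up-or-down bc
  ...   | inj₂ down = inj₂ (there (proj₂
          (descend l u (z∉ ∘ there) (λ _ b≡z → z∉ (here (sym b≡z))) bc∷ down)))
  ...   | inj₁ up with ascend l u (z∉ ∘ there) bc∷ up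
  ...     | inj₁ z<b = inj₁ (<-trans z<b b<a)
  ...     | inj₂ pz∈ = inj₂ (there pz∈)

  -- If the first step from `v` leads down, so do all others, and the rank of `v` would exceed
  -- itself. Otherwise the second vertex is the parent of `v`. The rest of the cycle then either
  -- climbs all the way, against the ranks, or enters `v` from its parent, which would occur twice.
  acyclic : ∀ v vs → ¬ IsCycle G edges v vs
  acyclic v []           (() , _)
  acyclic v (_ ∷ [])     (s≤s () , _)
  acyclic v (a ∷ b ∷ l) (_ , u@((v≢a ∷ v≢bl) ∷ a∷u) , (va ∷ ab∷)) with up-or-down va
  ... | inj₂ down = <-irrefl refl (proj₁ (descend (b ∷ l) u v∉ (λ ()) (va ∷ ab∷) down))
    where
    v∉ : v ∉ a ∷ b ∷ l
    v∉ v∈ = All.lookup (v≢a ∷ v≢bl) v∈ refl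
  ... | inj₁ (a≡pv , a<v) = impossible ab∷
    where
    v∉ : v ∉ b ∷ l
    v∉ v∈ = All.lookup v≢bl v∈ refl
    pv∉ : parent v ∉ b ∷ l
    pv∉ = subst (_∉ b ∷ l) a≡pv λ a∈ → All.lookup (AllPairs.head a∷u) a∈ refl
    impossible : ¬ Linked (Joined G edges) (a ∷ b ∷ l ++ [ v ])
    impossible ab∷@(ab ∷ _) with up-or-down ab
    ... | inj₂ down = pv∉ (proj₂ (descend l a∷u v∉ (λ _ a≡v → v≢a (sym a≡v)) ab∷ down))
    ... | inj₁ up with ascend l a∷u v∉ ab∷ up
    ...   | inj₁ v<a = <-asym v<a a<v
    ...   | inj₂ pv∈ = pv∉ pv∈

  isSpanningTree : IsSpanningTree G edges
  isSpanningTree = record { isEdgeSet = isEdgeSet ; connected = connected ; acyclic = acyclic }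

-- The graphs of the adversary.

1ℝ : ℝ
1ℝ = fromℚ 1ℚ

module Grid (m : ℕ) where

  k : ℕ
  k = suc m

  V : Set
  V = Fin (k * k)

  opaque
    block pos : V → Fin k
    block = quotient {k} k
    pos   = remainder {k} k

    at : Fin k → Fin k → V
    at = combine

    at-block-pos : ∀ v → at (block v) (pos v) ≡ v
    at-block-pos = combine-remQuot {k} k

    block-at : ∀ q r → block (at q r) ≡ q
    block-at q r = cong proj₁ (remQuot-combine q r)

    pos-at : ∀ q r → pos (at q r) ≡ r
    pos-at q r = cong proj₂ (remQuot-combine q r)

  open import Data.List.Membership.DecPropositional (_≟F_ {k * k}) using (_∈?_) public

  vertices : List V
  vertices = allFin (k * k)

  Mates : V → V → Set
  Mates u v = u ≢ v × block u ≡ block v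

  mates? : ∀ u v → Dec (Mates u v)
  mates? u v = ¬? (u ≟F v) ×-dec (block u ≟F block v)

  mates : V → List V
  mates v = filter (mates? v) vertices

  inBlock : Fin k → List V
  inBlock q = map (at q) (allFin k)

  ∈-inBlock : ∀ {q v} → block v ≡ q → v ∈ inBlock q
  ∈-inBlock {v = v} refl = subst (_∈ inBlock (block v)) (at-block-pos v) (∈-map⁺ (at (block v)) (∈-allFin (pos v)))

  length-inBlock : ∀ q → length (inBlock q) ≡ k
  length-inBlock q = trans (length-map (at q) (allFin k)) (length-tabulate {n = k} id)

  inBlock-unique : ∀ q → Unique (inBlock q)
  inBlock-unique q = Unique.map⁺
    (λ {x} {y} eq → trans (sym (pos-at q x)) (trans (cong pos eq) (pos-at q y))) (Unique.allFin⁺ k)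

  inBlock⁻ : ∀ {q v} → v ∈ inBlock q → block v ≡ q
  inBlock⁻ {q} v∈ = lemma (allFin k) v∈
    where
    lemma : ∀ rs {v} → v ∈ map (at q) rs → block v ≡ q
    lemma (r ∷ rs) (here refl) = block-at q r
    lemma (r ∷ rs) (there v∈)  = lemma rs v∈

  m≤length-mates : ∀ v → m ≤ length (mates v)
  m≤length-mates v = +-cancelˡ-≤ 1 _ _ (subst (_≤ suc (length (mates v))) (length-inBlock (block v))
    (unique-⊆⇒length≤ (inBlock-unique (block v)) sub))
    where
    sub : inBlock (block v) ⊆ v ∷ mates v
    sub {u} u∈ with v ≟F u
    ... | yes v≡u = here (sym v≡u)
    ... | no  v≢u = there (∈-filter⁺ (mates? v) (∈-allFin u) (v≢u , sym (inBlock⁻ u∈)))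

  -- Each value determines one graph. The graphs still possible after part of a run are those whose
  -- `probed` contains every vertex accessed so far.
  record Config : Set where
    field
      probed : List V
      hub    : Fin k
      avoids : ∀ {v} → v ∈ probed → block v ≢ hub

  module Instance (c : Config) where
    open Config c

    root : V
    root = at hub zero

    parent : V → V
    parent v = at hub (if does (block v ≟F hub) then zero else pos v)

    parent-hub : ∀ {v} → block v ≡ hub → parent v ≡ root
    parent-hub {v} eq = cong (λ b → at hub (if b then zero else pos v)) (dec-true (block v ≟F hub) eq)

    parent-outside : ∀ {v} → block v ≢ hub → parent v ≡ at hub (pos v)
    parent-outside {v} neq = cong (λ b → at hub (if b then zero else pos v)) (dec-false (block v ≟F hub) neq)

    block-parent : ∀ v → block (parent v) ≡ hub
    block-parent v = block-at hub _

    -- The depth in the tree, except that every vertex outside the hub gets 2, even one whose parent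
    -- is the root.
    rank : V → ℕ
    rank v = if does (block v ≟F hub) then (if does (v ≟F root) then 0 else 1) else 2

    rank-parent : ∀ {v} → v ≢ parent v → rank (parent v) < rank v
    rank-parent {v} v≢ with block v ≟F hub in eq
    ... | no _
      rewrite dec-true (block (at hub (pos v)) ≟F hub) (block-at hub (pos v))
      with does (at hub (pos v) ≟F root)
    ...   | true  = s≤s z≤n
    ...   | false = s≤s (s≤s z≤n)
    rank-parent {v} v≢ | yes _
      rewrite dec-true (block root ≟F hub) (block-at hub zero) | dec-true (root ≟F root) refl
            | dec-false (v ≟F root) v≢ = s≤s z≤n

    fixed⇒root : ∀ {v} → v ≡ parent v → v ≡ root
    fixed⇒root {v} v≡ = trans v≡ (parent-hub (trans (cong block v≡) (block-parent v)))

    -- The edges of weight 0 and those of weight 1. One probed end suffices in `Probe`: this gives a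
    -- probed vertex all its mates and keeps adjacency symmetric.
    Tree Probe : V → V → Set
    Tree  u v = u ≢ v × (v ≡ parent u ⊎ u ≡ parent v)
    Probe u v = Mates u v × (u ∈ probed ⊎ v ∈ probed)

    tree? : ∀ u v → Dec (Tree u v)
    tree? u v = ¬? (u ≟F v) ×-dec ((v ≟F parent u) ⊎-dec (u ≟F parent v))

    probe? : ∀ u v → Dec (Probe u v)
    probe? u v = mates? u v ×-dec ((u ∈? probed) ⊎-dec (v ∈? probed))

    -- One end of a tree edge is a parent and so lies in the hub, whereas an edge of `Probe` stays
    -- within the block of a probed vertex.
    probe⇒¬tree : ∀ {u v} → Probe u v → ¬ Tree u v
    probe⇒¬tree {u} {v} ((_ , same) , p) (_ , t) =
      Sum.[ (λ u∈ → avoids u∈ (inHub t)) , (λ v∈ → avoids v∈ (trans (sym same) (inHub t))) ]′ p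
      where
      inHub : v ≡ parent u ⊎ u ≡ parent v → block u ≡ hub
      inHub (inj₁ v≡) = trans same (trans (cong block v≡) (block-parent u))
      inHub (inj₂ u≡) = trans (cong block u≡) (block-parent v)

    -- Here the ends may lie in different blocks, as the algorithm may emit any pair. The end that
    -- is a parent would lie in the hub.
    probed⇒¬tree : ∀ {u v} → u ∈ probed → v ∈ probed → ¬ Tree u v
    probed⇒¬tree {u} {v} u∈ v∈ (_ , inj₁ v≡) = avoids v∈ (trans (cong block v≡) (block-parent u))
    probed⇒¬tree {u} {v} u∈ v∈ (_ , inj₂ u≡) = avoids u∈ (trans (cong block u≡) (block-parent v))

    -- The order hides the tree: a probed vertex returns all its mates before its tree edge.
    probes leaves nbrs : V → List V
    probes v = filter (probe? v) vertices
    leaves v = filter (tree? v) vertices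
    nbrs   v = probes v ++ leaves v

    ∈-probes⁻ : ∀ u {v} → v ∈ probes u → Probe u v
    ∈-probes⁻ u v∈ = proj₂ (∈-filter⁻ (probe? u) {xs = vertices} v∈)

    ∈-leaves⁻ : ∀ u {v} → v ∈ leaves u → Tree u v
    ∈-leaves⁻ u v∈ = proj₂ (∈-filter⁻ (tree? u) {xs = vertices} v∈)

    ∈-nbrs⁻ : ∀ u {v} → v ∈ nbrs u → Probe u v ⊎ Tree u v
    ∈-nbrs⁻ u v∈ = Sum.map (∈-probes⁻ u) (∈-leaves⁻ u) (∈-++⁻ (probes u) v∈)

    ∈-nbrs⁺ : ∀ {u v} → Probe u v ⊎ Tree u v → v ∈ nbrs u
    ∈-nbrs⁺ {u} {v} (inj₁ p) = ∈-++⁺ˡ (∈-filter⁺ (probe? u) (∈-allFin v) p)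
    ∈-nbrs⁺ {u} {v} (inj₂ t) = ∈-++⁺ʳ (probes u) (∈-filter⁺ (tree? u) (∈-allFin v) t)

    tree-sym : ∀ {u v} → Tree u v → Tree v u
    tree-sym (u≢v , t) = ≢-sym u≢v , swap t

    probe-sym : ∀ {u v} → Probe u v → Probe v u
    probe-sym ((u≢v , same) , p) = (≢-sym u≢v , sym same) , swap p

    edgeWeight : V → V → ℝ
    edgeWeight u v = if does (tree? u v) then 0ℝ else 1ℝ

    edgeWeight-tree : ∀ u v → Tree u v → edgeWeight u v ≡ 0ℝ
    edgeWeight-tree u v t = cong (if_then 0ℝ else 1ℝ) (dec-true (tree? u v) t)

    edgeWeight-¬tree : ∀ u v → ¬ Tree u v → edgeWeight u v ≡ 1ℝ
    edgeWeight-¬tree u v ¬t = cong (if_then 0ℝ else 1ℝ) (dec-false (tree? u v) ¬t)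

    nbrs-unique : ∀ v → Unique (nbrs v)
    nbrs-unique v = Unique.++⁺
      (Unique.filter⁺ (probe? v) (Unique.allFin⁺ _))
      (Unique.filter⁺ (tree? v) (Unique.allFin⁺ _))
      λ (p , t) → probe⇒¬tree (∈-probes⁻ v p) (∈-leaves⁻ v t)

    graph : Graph
    graph = record
      { n           = k * k
      ; adj         = nbrs
      ; adj-unique  = nbrs-unique
      ; adj-irrefl  = λ v v∈ → Sum.[ (λ p → proj₁ (proj₁ p) refl) , (λ t → proj₁ t refl) ]′ (∈-nbrs⁻ v v∈)
      ; adj-sym     = λ u v v∈ → ∈-nbrs⁺ (Sum.map probe-sym tree-sym (∈-nbrs⁻ u v∈))
      ; weight      = edgeWeight
      ; weight-sym  = λ u v _ → weight-sym u v
      }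
      where
      weight-sym : ∀ u v → edgeWeight u v ≡ edgeWeight v u
      weight-sym u v = Sum.[ (λ t → trans (edgeWeight-tree u v t) (sym (edgeWeight-tree v u (tree-sym t))))
                           , (λ ¬t → trans (edgeWeight-¬tree u v ¬t) (sym (edgeWeight-¬tree v u (¬t ∘ tree-sym)))) ]′
                           (toSum (tree? u v))

    probes≡mates : ∀ {v} → v ∈ probed → probes v ≡ mates v
    probes≡mates {v} v∈ = filter-≐ (probe? v) (mates? v) (proj₁ , (_, inj₁ v∈)) vertices

    -- A vertex with children lies in the hub, so the only tree edge at a probed vertex leads to its
    -- parent.
    length-leaves : ∀ {v} → v ∈ probed → length (leaves v) ≡ 1
    length-leaves {v} v∈ = ≤-antisym
      (unique-⊆⇒length≤ {ys = [ parent v ]} (Unique.filter⁺ (tree? v) (Unique.allFin⁺ _))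
        (here ∘ onlyParent ∘ ∈-leaves⁻ v))
      (unique-⊆⇒length≤ {xs = [ parent v ]} ([] ∷ []) λ where
        (here refl) → ∈-filter⁺ (tree? v) (∈-allFin (parent v)) (v≢parent , inj₁ refl))
      where
      v≢parent : v ≢ parent v
      v≢parent v≡ = avoids v∈ (trans (cong block v≡) (block-parent v))
      onlyParent : ∀ {u} → Tree v u → u ≡ parent v
      onlyParent     (_ , inj₁ u≡) = u≡
      onlyParent {u} (_ , inj₂ v≡) = contradiction (trans (cong block v≡) (block-parent u)) (avoids v∈)

    -- The right-hand side depends neither on the hub nor on the other probed vertices, so a degree
    -- query can be answered before they are chosen.
    deg-probed : ∀ {v} → v ∈ probed → deg graph v ≡ length (mates v) + 1
    deg-probed {v} v∈ = trans (length-++ (probes v)) (cong₂ _+_ (cong length (probes≡mates v∈)) (length-leaves v∈))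

    weight-mates : ∀ {u v} → u ∈ probed → v ∈ mates u → edgeWeight u v ≡ 1ℝ
    weight-mates {u} {v} u∈ v∈ = edgeWeight-¬tree u v
      (probe⇒¬tree (proj₂ (∈-filter⁻ (mates? u) {xs = vertices} v∈) , inj₁ u∈))

    tree-adjacent : ∀ {v} → v ≢ parent v → Adjacent graph v (parent v)
    tree-adjacent v≢ = ∈-nbrs⁺ (inj₂ (v≢ , inj₁ refl))

    open RootedTree graph root parent rank rank-parent fixed⇒root tree-adjacent public
      using (edges; ∈-edges⁻; isSpanningTree) renaming (connected to tree-connected)

    connected : Connected graph
    connected u v = Star.map joined⇒adjacent (tree-connected u v)
      where
      joined⇒adjacent : ∀ {u v} → Joined graph edges u v → Adjacent graph u v
      joined⇒adjacent (inj₁ p) = All.lookup (proj₁ (IsSpanningTree.isEdgeSet isSpanningTree)) p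
      joined⇒adjacent (inj₂ p) = Graph.adj-sym graph _ _ (All.lookup (proj₁ (IsSpanningTree.isEdgeSet isSpanningTree)) p)

    -- Maximum and average degree.

    k≤maxDegree : ∀ {v} → v ∈ probed → k ≤ maxDegree graph
    k≤maxDegree {v} v∈ = ≤-trans
      (≤-trans (≤-reflexive (+-comm 1 m)) (≤-trans (+-monoˡ-≤ 1 (m≤length-mates v)) (≤-reflexive (sym (deg-probed v∈)))))
      (All.lookup (xs≤max 0 (map (deg graph) vertices)) (∈-map⁺ (deg graph) {x = v} (∈-allFin v)))

    -- A mate lies in the block of `v`, the parent in the hub, and a child in the hub or at the same
    -- position as `v` in another block. These are three lists of `k` vertices each.
    maxDegree≤3k : maxDegree graph ≤ 3 * k
    maxDegree≤3k = max≤v⁺ {xs = map (deg graph) vertices} z≤n (All.map⁺ (All.universal bound vertices))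
      where
      column : V → List V
      column v = map (λ q → at q (pos v)) (allFin k)
      child : ∀ {u v} → v ≡ parent u → Dec (block u ≡ hub) → u ∈ inBlock hub ++ column v
      child _ (yes inHub) = ∈-++⁺ˡ (∈-inBlock inHub)
      child {u} {v} v≡ (no ¬inHub) = ∈-++⁺ʳ (inBlock hub)
        (subst (_∈ column v) (trans (cong (at (block u)) pos≡) (at-block-pos u))
          (∈-map⁺ (λ q → at q (pos v)) (∈-allFin (block u))))
        where
        pos≡ : pos v ≡ pos u
        pos≡ = trans (cong pos (trans v≡ (parent-outside ¬inHub))) (pos-at hub (pos u))
      sub : ∀ v → nbrs v ⊆ inBlock (block v) ++ inBlock hub ++ column v
      sub v {u} u∈ with ∈-nbrs⁻ v u∈
      ... | inj₁ ((_ , same) , _) = ∈-++⁺ˡ (∈-inBlock (sym same))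
      ... | inj₂ (_ , inj₁ u≡)    =
        ∈-++⁺ʳ (inBlock (block v)) (∈-++⁺ˡ (∈-inBlock (trans (cong block u≡) (block-parent v))))
      ... | inj₂ (_ , inj₂ v≡)    = ∈-++⁺ʳ (inBlock (block v)) (child v≡ (block u ≟F hub))
      bound : ∀ v → deg graph v ≤ 3 * k
      bound v = ≤-trans (unique-⊆⇒length≤ (nbrs-unique v) (sub v)) (≤-reflexive (begin
        length (inBlock (block v) ++ inBlock hub ++ column v)
          ≡⟨ trans (length-++ (inBlock (block v)))
               (cong (length (inBlock (block v)) +_) (length-++ (inBlock hub))) ⟩
        length (inBlock (block v)) + (length (inBlock hub) + length (column v))
          ≡⟨ cong₂ _+_ (length-inBlock (block v)) (cong₂ _+_ (length-inBlock hub)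
               (trans (length-map _ (allFin k)) (length-tabulate {n = k} id))) ⟩
        k + (k + k)  ≡⟨ cong (λ x → k + (k + x)) (sym (+-identityʳ k)) ⟩
        3 * k ∎))
        where open ≡-Reasoning

    -- Four lists of at most `k * k` arcs cover all arcs: those from a probed vertex into its block,
    -- those from a vertex to its parent, and the reverses of both. As there are `k * k` vertices,
    -- the average degree is at most 4.
    sum-deg≤ : length probed ≤ k → sum (map (deg graph) vertices) ≤ 4 * (k * k)
    sum-deg≤ few = ≤-trans (≤-reflexive (sym (length-arcs nbrs vertices)))
      (≤-trans (unique-⊆⇒length≤ (arcs-unique nbrs nbrs-unique (Unique.allFin⁺ (k * k))) sub) length-cover)
      where
      fromProbed toProbed up down cover : List (V × V)
      fromProbed = cartesianProductWith (λ s r → s , at (block s) r) probed (allFin k)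
      toProbed   = cartesianProductWith (λ s r → at (block s) r , s) probed (allFin k)
      up         = map (λ v → v , parent v) vertices
      down       = map (λ v → parent v , v) vertices
      cover      = fromProbed ++ toProbed ++ up ++ down
      sub : arcs nbrs vertices ⊆ cover
      sub {u , v} p with ∈-nbrs⁻ u (proj₂ (∈-arcs⁻ nbrs vertices p))
      ... | inj₁ ((_ , same) , inj₁ u∈) = ∈-++⁺ˡ (subst (λ x → (u , x) ∈ fromProbed)
              (trans (cong (λ q → at q (pos v)) same) (at-block-pos v))
              (∈-cartesianProductWith⁺ (λ s r → s , at (block s) r) u∈ (∈-allFin (pos v))))
      ... | inj₁ ((_ , same) , inj₂ v∈) = ∈-++⁺ʳ fromProbed (∈-++⁺ˡ (subst (λ x → (x , v) ∈ toProbed)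
              (trans (cong (λ q → at q (pos u)) (sym same)) (at-block-pos u))
              (∈-cartesianProductWith⁺ (λ s r → at (block s) r , s) v∈ (∈-allFin (pos u)))))
      ... | inj₂ (_ , inj₁ refl) = ∈-++⁺ʳ fromProbed
              (∈-++⁺ʳ toProbed (∈-++⁺ˡ (∈-map⁺ (λ v → v , parent v) (∈-allFin u))))
      ... | inj₂ (_ , inj₂ refl) = ∈-++⁺ʳ fromProbed
              (∈-++⁺ʳ toProbed (∈-++⁺ʳ up (∈-map⁺ (λ v → parent v , v) (∈-allFin v))))
      product≤ : ∀ f → length (cartesianProductWith {B = Fin k} {C = V × V} f probed (allFin k)) ≤ k * k
      product≤ f = ≤-trans (≤-reflexive (trans (length-cartesianProductWith f probed (allFin k))
        (cong (length probed *_) (length-tabulate {n = k} id)))) (*-monoˡ-≤ k few)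
      map≤ : ∀ f → length (map {B = V × V} f vertices) ≤ k * k
      map≤ f = ≤-reflexive (trans (length-map f vertices) (length-tabulate {n = k * k} id))
      length-cover : length cover ≤ 4 * (k * k)
      length-cover = begin
        length cover
          ≡⟨ trans (length-++ fromProbed) (cong (length fromProbed +_) (trans (length-++ toProbed)
               (cong (length toProbed +_) (length-++ up)))) ⟩
        length fromProbed + (length toProbed + (length up + length down))
          ≤⟨ +-mono-≤ (product≤ _) (+-mono-≤ (product≤ _) (+-mono-≤ (map≤ _) (≤-trans (map≤ _) (m≤m+n _ 0)))) ⟩
        4 * (k * k) ∎
        where open ≤-Reasoning

    -- Weights of spanning trees.

    totalWeight-edges : ∀ i → approx (totalWeight graph edges) i ≡ 0ℚ
    totalWeight-edges i = lemma edges λ {e} e∈ →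
      cong (λ x → approx x i) (edgeWeight-tree (proj₁ e) (proj₂ e) (edge⇒tree e∈))
      where
      edge⇒tree : ∀ {e} → e ∈ edges → Tree (proj₁ e) (proj₂ e)
      edge⇒tree e∈ = let v≡ , v<u = ∈-edges⁻ e∈ in (λ { refl → <-irrefl refl v<u }) , inj₁ v≡
      lemma : ∀ es → (∀ {e} → e ∈ es → approx (edgeWeight (proj₁ e) (proj₂ e)) i ≡ 0ℚ) →
              approx (totalWeight graph es) i ≡ 0ℚ
      lemma []       _ = refl
      lemma (e ∷ es) w = trans (cong₂ ℚ._+_ (w (here refl)) (lemma es (w ∘ there))) (ℚ.+-identityˡ 0ℚ)

    0≤totalWeight : ∀ es i → 0ℚ ℚ.≤ approx (totalWeight graph es) i
    0≤totalWeight []             i = ℚ.≤-refl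
    0≤totalWeight ((u , v) ∷ es) i =
      ℚ.≤-trans (ℚ.≤-reflexive (sym (ℚ.+-identityˡ 0ℚ))) (ℚ.+-mono-≤ 0≤weight (0≤totalWeight es i))
      where
      0≤weight : 0ℚ ℚ.≤ approx (edgeWeight u v) i
      0≤weight with does (tree? u v)
      ... | true  = ℚ.≤-refl
      ... | false = ℚ.nonNegative⁻¹ 1ℚ

    1≰½ : ¬ 1ℚ ℚ.≤ ½
    1≰½ = from-no (1ℚ ℚ.≤? ½)

    -- A probed vertex has a mate, at weight 1, because `m` is positive, and it is joined to its
    -- parent at weight 0.
    twoWeights : ∀ {v} → v ∈ probed → 0 < m → TwoWeights graph
    twoWeights {v} v∈ 0<m with mates v in eq | m≤length-mates v
    ... | []    | m≤0 = contradiction (≤-trans 0<m m≤0) λ ()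
    ... | u ∷ _ | _   = v , u , v , parent v
        , ∈-nbrs⁺ (inj₁ (vu , inj₁ v∈)) , tree-adjacent v≢parent
        , λ w≈w′ → 1≉0 (subst (_≤ℝ edgeWeight v (parent v))
            (edgeWeight-¬tree v u (probe⇒¬tree (vu , inj₁ v∈))) (proj₁ w≈w′))
      where
      vu : Mates v u
      vu = proj₂ (∈-filter⁻ (mates? v) {xs = vertices} (subst (u ∈_) (sym eq) (here refl)))
      v≢parent : v ≢ parent v
      v≢parent v≡ = avoids v∈ (trans (cong block v≡) (block-parent v))
      1≉0 : ¬ 1ℝ ≤ℝ edgeWeight v (parent v)
      1≉0 1≤ rewrite edgeWeight-tree v (parent v) (v≢parent , inj₁ refl) =
        let N , le = 1≤ ½ (ℚ.positive⁻¹ ½) in 1≰½ (ℚ.≤-trans (le N ≤-refl) (ℚ.≤-reflexive (ℚ.+-identityˡ ½)))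

    -- The first pair has weight 1, whether or not it is an edge, and no weight is negative, while
    -- the hidden tree has weight 0. A tolerance of `½` in the order of the reals separates the two
    -- totals.
    probed∷¬MST : ∀ {u v es} → u ∈ probed → v ∈ probed → ¬ IsMST graph ((u , v) ∷ es)
    probed∷¬MST {u} {v} {es} u∈ v∈ (_ , minimal) =
      let N , le = minimal edges isSpanningTree ½ (ℚ.positive⁻¹ ½) in 1≰½ (begin
        1ℚ                                          ≡⟨ sym (ℚ.+-identityʳ 1ℚ) ⟩
        1ℚ ℚ.+ 0ℚ                                   ≤⟨ ℚ.+-monoʳ-≤ 1ℚ (0≤totalWeight es N) ⟩
        1ℚ ℚ.+ approx (totalWeight graph es) N      ≡⟨ cong (λ w → approx w N ℚ.+ approx (totalWeight graph es) N)
                                                         (sym (edgeWeight-¬tree u v (probed⇒¬tree u∈ v∈))) ⟩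
        approx (totalWeight graph ((u , v) ∷ es)) N ≤⟨ le N ≤-refl ⟩
        approx (totalWeight graph edges) N ℚ.+ ½    ≡⟨ cong (ℚ._+ ½) (totalWeight-edges N) ⟩
        0ℚ ℚ.+ ½                                    ≡⟨ ℚ.+-identityˡ ½ ⟩
        ½ ∎)
      where open ℚ.≤-Reasoning

-- Comparing the runs of one program on different graphs.

fetch-++ˡ : {A : Set} (xs ys : List A) {i : ℕ} → i < length xs → fetch (xs ++ ys) i ≡ fetch xs i
fetch-++ˡ (x ∷ xs) ys {zero}  _         = refl
fetch-++ˡ (x ∷ xs) ys {suc i} (s≤s i<) = fetch-++ˡ xs ys i<

fetch-∈ : {A : Set} (xs : List A) (i : ℕ) {x : A} → fetch xs i ≡ just x → x ∈ xs
fetch-∈ (x ∷ xs) zero    refl = here refl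
fetch-∈ (x ∷ xs) (suc i) eq   = there (fetch-∈ xs i eq)

length-fromMaybe : {A : Set} (x : Maybe A) → length (fromMaybe x) ≤ 1
length-fromMaybe nothing  = z≤n
length-fromMaybe (just _) = ≤-refl

module Runs (I : InstructionSet) (w : ℕ) (P : Program I) (m : ℕ) where

  open Grid m
  open Config

  module G (c : Config) where
    open Instance c public
    open Execution I w (Instance.graph c) public

  -- The states of runs on different graphs have different types; their components do not.
  record Snapshot : Set where
    no-eta-equality
    field
      pc       : ℕ
      mem      : Cell → Word w
      memW     : Cell → ℝ
      returned : V → ℕ
      output   : List (V × V)

  open Snapshot

  state : ∀ c → Snapshot → G.State c
  state c x = record { Snapshot x }

  snapshot : ∀ c → G.State c → Snapshot
  snapshot c s = record { Execution.State s }

  execute : Config → Instr I → Snapshot → Snapshot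
  execute c i x = snapshot c (G.execute c i (state c x))

  -- A form of `readVertex` that mentions no configuration; all the graphs have the same `k * k`
  -- vertices.
  vertexAt : (Cell → Word w) → List Cell → Maybe V
  vertexAt μ cs with readNumber w μ cs <? k * k
  ... | yes v<n = just (fromℕ< v<n)
  ... | no  _   = nothing

  readVertex≡ : ∀ c μ cs → G.readVertex c μ cs ≡ vertexAt μ cs
  readVertex≡ c μ cs with readNumber w μ cs <? k * k
  ... | yes _ = refl
  ... | no  _ = refl

  -- Ends of emitted pairs count as accessed too, so that every emitted pair joins two accessed
  -- vertices.
  operands : Instr I → Snapshot → List V
  operands (degreeQuery vs _)     x = fromMaybe (vertexAt (mem x) vs)
  operands (neighborQuery vs _ _) x = fromMaybe (vertexAt (mem x) vs)
  operands (emit us vs)           x = fromMaybe (vertexAt (mem x) us) ++ fromMaybe (vertexAt (mem x) vs)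
  operands _                      x = []

  length-operands : ∀ i x → length (operands i x) ≤ 2
  length-operands (const _ _)             x = z≤n
  length-operands (apply _ _ _ _)         x = z≤n
  length-operands (load _ _)              x = z≤n
  length-operands (store _ _)             x = z≤n
  length-operands (applyW _ _ _ _)        x = z≤n
  length-operands (testW _ _ _ _)         x = z≤n
  length-operands (loadW _ _)             x = z≤n
  length-operands (storeW _ _)            x = z≤n
  length-operands (branch _ _)            x = z≤n
  length-operands (order _)               x = z≤n
  length-operands (degreeQuery vs _)      x = m≤n⇒m≤1+n (length-fromMaybe (vertexAt (mem x) vs))
  length-operands (neighborQuery vs _ _)  x = m≤n⇒m≤1+n (length-fromMaybe (vertexAt (mem x) vs))
  length-operands (emit us vs)            x = ≤-trans (≤-reflexive (length-++ (fromMaybe (vertexAt (mem x) us))))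
    (+-mono-≤ (length-fromMaybe (vertexAt (mem x) us)) (length-fromMaybe (vertexAt (mem x) vs)))

  -- The list of a probed vertex begins with its mates, of which there are at least `m`; they are
  -- the same in every configuration.
  fetch-nbrs : ∀ c {v i} → v ∈ probed c → i < m → fetch (G.nbrs c v) i ≡ fetch (mates v) i
  fetch-nbrs c {v} {i} v∈ i<m = trans (cong (λ xs → fetch (xs ++ G.leaves c v) i) (G.probes≡mates c v∈))
    (fetch-++ˡ (mates v) (G.leaves c v) (≤-trans i<m (m≤length-mates v)))

  -- Only queries look at the graph. For a probed vertex the degree is the same in both
  -- configurations, and so are the first `m` list entries, all returned with weight 1.
  execute-cong : ∀ c c′ i x → operands i x ⊆ probed c → operands i x ⊆ probed c′ →
                 (∀ v → returned x v < m) → execute c i x ≡ execute c′ i x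
  execute-cong c c′ (const _ _)      x _ _ _ = refl
  execute-cong c c′ (apply _ _ _ _)  x _ _ _ = refl
  execute-cong c c′ (load _ _)       x _ _ _ = refl
  execute-cong c c′ (store _ _)      x _ _ _ = refl
  execute-cong c c′ (applyW _ _ _ _) x _ _ _ = refl
  execute-cong c c′ (testW _ _ _ _)  x _ _ _ = refl
  execute-cong c c′ (loadW _ _)      x _ _ _ = refl
  execute-cong c c′ (storeW _ _)     x _ _ _ = refl
  execute-cong c c′ (branch b _)     x _ _ _ with toℕ (mem x b) ≟ 0
  ... | yes _ = refl
  ... | no  _ = refl
  execute-cong c c′ (order _)        x _ _ _ = refl
  execute-cong c c′ (degreeQuery vs ds) x p p′ _
    rewrite readVertex≡ c (mem x) vs | readVertex≡ c′ (mem x) vs with vertexAt (mem x) vs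
  ... | nothing = refl
  ... | just v  rewrite G.deg-probed c (p (here refl)) | G.deg-probed c′ (p′ (here refl)) = refl
  execute-cong c c′ (neighborQuery vs ds d) x p p′ r
    rewrite readVertex≡ c (mem x) vs | readVertex≡ c′ (mem x) vs with vertexAt (mem x) vs
  ... | nothing = refl
  ... | just v
    rewrite fetch-nbrs c (p (here refl)) (r v) | fetch-nbrs c′ (p′ (here refl)) (r v)
    with fetch (mates v) (returned x v) in eq
  ...   | nothing = refl
  ...   | just u
    rewrite G.weight-mates c (p (here refl)) (fetch-∈ (mates v) _ eq)
          | G.weight-mates c′ (p′ (here refl)) (fetch-∈ (mates v) _ eq) = refl
  execute-cong c c′ (emit us vs) x _ _ _
    rewrite readVertex≡ c (mem x) us | readVertex≡ c′ (mem x) us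
          | readVertex≡ c (mem x) vs | readVertex≡ c′ (mem x) vs with vertexAt (mem x) us | vertexAt (mem x) vs
  ... | nothing | nothing = refl
  ... | nothing | just _  = refl
  ... | just _  | nothing = refl
  ... | just _  | just _  = refl

  Between : List V → V × V → Set
  Between vs (u , v) = u ∈ vs × v ∈ vs

  record Progress (vs : List V) (x y : Snapshot) : Set where
    constructor progress
    field
      returned≤ : ∀ v → returned y v ≤ suc (returned x v)
      emitted   : List (V × V)
      output≡   : output y ≡ output x ++ emitted
      between   : All (Between vs) emitted

  open Progress

  silent : ∀ {vs x y} → returned y ≡ returned x → output y ≡ output x → Progress vs x y
  silent r o = progress (λ v → m≤n⇒m≤1+n (≤-reflexive (cong (λ f → f v) r))) []
    (trans o (sym (++-identityʳ _))) []

  execute-progress : ∀ c i x → Progress (operands i x) x (execute c i x)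
  execute-progress c (const _ _)      x = silent refl refl
  execute-progress c (apply _ _ _ _)  x = silent refl refl
  execute-progress c (load _ _)       x = silent refl refl
  execute-progress c (store _ _)      x = silent refl refl
  execute-progress c (applyW _ _ _ _) x = silent refl refl
  execute-progress c (testW _ _ _ _)  x = silent refl refl
  execute-progress c (loadW _ _)      x = silent refl refl
  execute-progress c (storeW _ _)     x = silent refl refl
  execute-progress c (branch b _)     x with toℕ (mem x b) ≟ 0
  ... | yes _ = silent refl refl
  ... | no  _ = silent refl refl
  execute-progress c (order _)        x = silent refl refl
  execute-progress c (degreeQuery vs ds) x with G.readVertex c (mem x) vs
  ... | nothing = silent refl refl
  ... | just _  = silent refl refl
  execute-progress c (neighborQuery vs ds d) x with G.readVertex c (mem x) vs
  ... | nothing = silent refl refl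
  ... | just v with fetch (G.nbrs c v) (returned x v)
  ...   | nothing = silent refl refl
  ...   | just _  = progress advance≤ [] (sym (++-identityʳ (output x))) []
    where
    advance≤ : ∀ u → G.advance c v (returned x) u ≤ suc (returned x u)
    advance≤ u with toℕ v ≟ toℕ u
    ... | yes _ = ≤-refl
    ... | no  _ = n≤1+n _
  execute-progress c (emit us vs) x rewrite readVertex≡ c (mem x) us | readVertex≡ c (mem x) vs
    with vertexAt (mem x) us | vertexAt (mem x) vs
  ... | nothing | nothing = silent refl refl
  ... | nothing | just _  = silent refl refl
  ... | just _  | nothing = silent refl refl
  ... | just u  | just v  = progress (λ _ → n≤1+n _) [ (u , v) ] refl ((here refl , there (here refl)) ∷ [])

  opaque

    step : Config → Snapshot → Snapshot
    step c x = snapshot c (G.step c P (state c x))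

    run : Config → ℕ → Snapshot
    run c t = snapshot c (G.stateAt c P t)

    run-zero : ∀ c c′ → run c 0 ≡ run c′ 0
    run-zero _ _ = refl

    returned-zero : ∀ c v → returned (run c 0) v ≤ 0
    returned-zero _ _ = z≤n

    output-zero : ∀ c → output (run c 0) ≡ []
    output-zero _ = refl

    run-suc : ∀ c t → run c (suc t) ≡ step c (run c t)
    run-suc _ _ = refl

    output-run : ∀ c t → output (run c t) ≡ G.outputAt c P t
    output-run _ _ = refl

    accessed : Snapshot → List V
    accessed x with fetch P (pc x)
    ... | nothing = []
    ... | just i  = operands i x

    length-accessed : ∀ x → length (accessed x) ≤ 2
    length-accessed x with fetch P (pc x)
    ... | nothing = z≤n
    ... | just i  = length-operands i x

    step-cong : ∀ c c′ x → accessed x ⊆ probed c → accessed x ⊆ probed c′ →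
                (∀ v → returned x v < m) → step c x ≡ step c′ x
    step-cong c c′ x p p′ r with fetch P (pc x)
    ... | nothing = refl
    ... | just i  = execute-cong c c′ i x p p′ r

    step-progress : ∀ c x → Progress (accessed x) x (step c x)
    step-progress c x with fetch P (pc x)
    ... | nothing = silent refl refl
    ... | just i  = execute-progress c i x

  output-mono : ∀ c {s t} → s ≤ t → length (output (run c s)) ≤ length (output (run c t))
  output-mono c {s} {t} s≤t with m≤n⇒m<n∨m≡n s≤t
  ... | inj₂ refl = ≤-refl
  output-mono c {s} {suc t} _ | inj₁ (s≤s s≤t) = ≤-trans (output-mono c s≤t) (begin
    length (output (run c t))                                 ≤⟨ m≤m+n _ _ ⟩
    length (output (run c t)) + length (emitted δ)            ≡⟨ sym (length-++ (output (run c t))) ⟩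
    length (output (run c t) ++ emitted δ)                    ≡⟨ cong length (sym (output≡ δ)) ⟩
    length (output (step c (run c t)))                        ≡⟨ cong (length ∘ output) (sym (run-suc c t)) ⟩
    length (output (run c (suc t))) ∎)
    where
    open ≤-Reasoning
    δ = step-progress c (run c t)

  opaque

    -- By the pigeonhole principle fewer than `k` vertices miss one of the `k` blocks, which becomes
    -- the hub.
    config : (vs : List V) → length vs < k → ∃ λ c → probed c ≡ vs
    config vs few with ¬∀⟶∃¬ k (_∈ map block vs) (λ q → DecMembership._∈?_ _≟F_ q (map block vs)) ¬all
      where
      ¬all : ¬ ∀ q → q ∈ map block vs
      ¬all all = <⇒≱ few (begin
        k                     ≡⟨ sym (length-tabulate {n = k} id) ⟩
        length (allFin k)     ≤⟨ unique-⊆⇒length≤ (Unique.allFin⁺ k) (λ {q} _ → all q) ⟩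
        length (map block vs) ≡⟨ length-map block vs ⟩
        length vs ∎)
        where open ≤-Reasoning
    ... | q , q∉ = record { probed = vs ; hub = q ; avoids = λ { v∈ refl → q∉ (∈-map⁺ block v∈) } } , refl

  -- The hub stays open: `same` ranges over all configurations in which the vertices in `seen` are
  -- probed, whichever further vertices they probe.
  record Explored (t : ℕ) : Set where
    field
      seen        : List V
      few         : length seen ≤ 2 * t
      same        : ∀ c c′ → seen ⊆ probed c → seen ⊆ probed c′ → run c t ≡ run c′ t
      returned≤t  : ∀ c → seen ⊆ probed c → ∀ v → returned (run c t) v ≤ t
      outputIn    : ∀ c → seen ⊆ probed c → All (Between seen) (output (run c t))

  open Explored

  opaque

    -- The run up to time t is determined by the at most 2t vertices it has accessed: any two graphs
    -- in which these are probed answer alike.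
    explore : ∀ t → 2 * t < k → t ≤ m → Explored t
    explore zero    _    _    = record
      { seen       = []
      ; few        = z≤n
      ; same       = λ c c′ _ _ → run-zero c c′
      ; returned≤t = λ c _ → returned-zero c
      ; outputIn   = λ c _ → subst (All (Between [])) (sym (output-zero c)) []
      }
    explore (suc t) 2+2t<k t<m = record
      { seen       = seen′
      ; few        = begin
          length (accessed x ++ seen e)         ≡⟨ length-++ (accessed x) ⟩
          length (accessed x) + length (seen e) ≤⟨ +-mono-≤ (length-accessed x) (few e) ⟩
          2 + 2 * t                             ≡⟨ sym (*-suc 2 t) ⟩
          2 * suc t ∎
      ; same       = λ c c′ p p′ → trans (run≡ c p) (trans
          (step-cong c c′ x (p ∘ ∈-++⁺ˡ) (p′ ∘ ∈-++⁺ˡ) (λ v → ≤-<-trans (returned≤t e c₀ old⊆ v) t<m))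
          (sym (run≡ c′ p′)))
      ; returned≤t = λ c p v → subst (λ y → returned y v ≤ suc t) (sym (run≡ c p))
          (≤-trans (returned≤ (step-progress c x) v) (s≤s (returned≤t e c₀ old⊆ v)))
      ; outputIn   = λ c p → subst (All (Between seen′) ∘ output) (sym (run≡ c p))
          (subst (All (Between seen′)) (sym (output≡ (step-progress c x))) (All.++⁺
            (All.map (λ (u∈ , v∈) → ∈-++⁺ʳ (accessed x) u∈ , ∈-++⁺ʳ (accessed x) v∈) (outputIn e c₀ old⊆))
            (All.map (λ (u∈ , v∈) → ∈-++⁺ˡ u∈ , ∈-++⁺ˡ v∈) (between (step-progress c x)))))
      }
      where
      open ≤-Reasoning
      2t<k : 2 * t < k
      2t<k = ≤-<-trans (*-monoʳ-≤ 2 (n≤1+n t)) 2+2t<k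
      e : Explored t
      e = explore t 2t<k (<⇒≤ t<m)
      -- Any configuration that probes the vertices seen so far yields the state at time `t`. This
      -- state tells which vertices the next step accesses, before a configuration that probes those
      -- as well is fixed.
      sample : ∃ λ c → probed c ≡ seen e
      sample = config (seen e) (≤-<-trans (few e) 2t<k)
      c₀ : Config
      c₀ = proj₁ sample
      old⊆ : seen e ⊆ probed c₀
      old⊆ {v} = subst (v ∈_) (sym (proj₂ sample))
      x : Snapshot
      x = run c₀ t
      seen′ : List V
      seen′ = accessed x ++ seen e
      run≡ : ∀ c → seen′ ⊆ probed c → run c (suc t) ≡ step c x
      run≡ c p = trans (run-suc c t) (cong (step c) (same e c c₀ (p ∘ ∈-++⁺ʳ (accessed x)) old⊆))

-- The empty edge set, and rational bounds as inequalities of natural numbers.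

joined-[] : (G : Graph) {u v : Vertex G} → Star (Joined G []) u v → u ≡ v
joined-[] G ε              = refl
joined-[] G (inj₁ () ◅ _)
joined-[] G (inj₂ () ◅ _)

≤-/ : ∀ s n {{_ : NonZero n}} → s ≤ 4 * n → ℤ.+ s ℚ./ n ℚ.≤ ℕ→ℚ 4
≤-/ s n@(suc n-1) s≤4n = ℚ.toℚᵘ-cancel-≤ (begin
  ℚ.toℚᵘ (ℤ.+ s ℚ./ n)  ≃⟨ ℚ.toℚᵘ-fromℚᵘ (ℚᵘ.mkℚᵘ (ℤ.+ s) n-1) ⟩
  ℚᵘ.mkℚᵘ (ℤ.+ s) n-1   ≤⟨ ℚᵘ.*≤* (ℤ.≤-trans (ℤ.≤-reflexive (ℤ.*-identityʳ (ℤ.+ s)))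
                           (ℤ.≤-trans (ℤ.+≤+ s≤4n) (ℤ.≤-reflexive (ℤ.pos-* 4 n)))) ⟩
  ℚᵘ.mkℚᵘ (ℤ.+ 4) 0     ≃⟨ ℚ.toℚᵘ-fromℚᵘ (ℚᵘ.mkℚᵘ (ℤ.+ 4) 0) ⟨
  ℚ.toℚᵘ (ℕ→ℚ 4)      ∎)
  where open ℚᵘ.≤-Reasoning

-- With `k = 2 + 2 * T` and `T` positive, the maximum degree is at most `3 * k`, hence at most
-- `12 * T`. Preprocessing and delay of at most a 24th of it each then sum to at most `T`.
ε₂₄ : ℚ
ε₂₄ = ℤ.+ 1 ℚ./ 24

≤-ε₂₄ : ∀ p Δ → ℚ.∣ ℕ→ℚ p ∣ ℚ.≤ ε₂₄ ℚ.* ℕ→ℚ Δ → p * 24 ≤ Δ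
≤-ε₂₄ p Δ p≤ = ℤ.drop‿+≤+ (begin
  ℤ.+ (p * 24)           ≡⟨ ℤ.pos-* p 24 ⟩
  ℤ.+ p ℤ.* ℤ.+ 24         ≤⟨ ℚᵘ.drop-*≤* unnormalised ⟩
  ℤ.+ 1 ℤ.* ℤ.+ Δ ℤ.* ℤ.+ 1  ≡⟨ trans (ℤ.*-identityʳ _) (ℤ.*-identityˡ (ℤ.+ Δ)) ⟩
  ℤ.+ Δ                  ∎)
  where
  open ℤ.≤-Reasoning
  toℚᵘ-ℕ→ℚ : ∀ a → ℚ.toℚᵘ (ℕ→ℚ a) ℚᵘ.≃ ℚᵘ.mkℚᵘ (ℤ.+ a) 0
  toℚᵘ-ℕ→ℚ a = ℚ.toℚᵘ-fromℚᵘ (ℚᵘ.mkℚᵘ (ℤ.+ a) 0)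
  unnormalised : ℚᵘ.mkℚᵘ (ℤ.+ p) 0 ℚᵘ.≤ ℚᵘ.mkℚᵘ (ℤ.+ 1) 23 ℚᵘ.* ℚᵘ.mkℚᵘ (ℤ.+ Δ) 0
  unnormalised = ℚᵘ.≤-respˡ-≃ (toℚᵘ-ℕ→ℚ p) (ℚᵘ.≤-respʳ-≃
    (ℚᵘ.≃-trans (ℚ.toℚᵘ-homo-* ε₂₄ (ℕ→ℚ Δ)) (ℚᵘ.*-congˡ {ℚᵘ.mkℚᵘ (ℤ.+ 1) 23} (toℚᵘ-ℕ→ℚ Δ)))
    (ℚ.toℚᵘ-mono-≤ (subst (ℚ._≤ _)
      (ℚ.0≤p⇒∣p∣≡p (ℚ.nonNegative⁻¹ (ℕ→ℚ p) {{ℚ.normalize-nonNeg p 1}})) p≤)))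

littleO⇒*24≤ : {A : Set} (f Δ : A → ℕ) → LittleO (λ a → ℕ→ℚ (f a)) Δ →
  ∃ λ N → ∀ a → N ≤ Δ a → f a * 24 ≤ Δ a
littleO⇒*24≤ f Δ f∈o with f∈o ε₂₄ (ℚ.positive⁻¹ ε₂₄)
... | N , f≤ = N , λ a N≤ → ≤-ε₂₄ (f a) (Δ a) (f≤ a N≤)

+≤-from-*24 : ∀ {p d Δ T} → 1 ≤ T → Δ ≤ 3 * (2 + 2 * T) → p * 24 ≤ Δ → d * 24 ≤ Δ → p + d ≤ T
+≤-from-*24 {p} {d} {Δ} {T} 1≤T Δ≤ p≤ d≤ = *-cancelʳ-≤ (p + d) T 24 (begin
  (p + d) * 24                       ≡⟨ *-distribʳ-+ 24 p d ⟩
  p * 24 + d * 24                    ≤⟨ +-mono-≤ (≤-trans p≤ Δ≤) (≤-trans d≤ Δ≤) ⟩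
  3 * (2 + 2 * T) + 3 * (2 + 2 * T)  ≡⟨ sym (*-distribʳ-+ (2 + 2 * T) 3 3) ⟩
  6 * (2 + 2 * T)                    ≤⟨ *-monoʳ-≤ 6 2+2T≤T*4 ⟩
  6 * (T * 4)                        ≡⟨ *-comm 6 (T * 4) ⟩
  T * 4 * 6                          ≡⟨ *-assoc T 4 6 ⟩
  T * 24                             ∎)
  where
  open ≤-Reasoning
  2+2T≤T*4 : 2 + 2 * T ≤ T * 4
  2+2T≤T*4 = begin
    2 + 2 * T      ≤⟨ +-monoˡ-≤ (2 * T) (*-monoʳ-≤ 2 1≤T) ⟩
    2 * T + 2 * T  ≡⟨ sym (*-distribʳ-+ T 2 2) ⟩
    4 * T          ≡⟨ *-comm 4 T ⟩
    T * 4          ∎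

-- The contradiction.

module _ (I : InstructionSet) (w : ℕ) (P : Program I) (m : ℕ) where

  open Grid m
  open Config
  open Runs I w P m
  open Explored

  -- The first edge is out by time `pre + delay`, hence by time `t`. Its ends have been accessed and
  -- are therefore probed in `c`, so no minimum spanning tree begins with it.
  tooSlow : ∀ {t pre delay v} (e : Explored t) (c : Config) → seen e ⊆ probed c → v ∈ probed c →
            pre + delay ≤ t → ¬ Enumerates I w (Instance.graph c) P pre delay
  tooSlow {t} {pre} {delay} {v} e c seen⊆ v∈ fast en = emitted (Snapshot.output (run c t)) refl
    where
    open Enumerates en
    open Instance c using (graph; parent; block-parent; probed∷¬MST)
    -- The probed vertex `v` lies outside the hub and its parent inside; the empty edge set does not
    -- connect them.
    tree-nonempty : ∀ es → IsMST graph es → 0 < length es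
    tree-nonempty (_ ∷ _) _         = s≤s z≤n
    tree-nonempty []      (st , _) = contradiction
      (trans (cong block (joined-[] graph (IsSpanningTree.connected st v (parent v)))) (block-parent v)) (avoids c v∈)
    0<output : 0 < length (Snapshot.output (run c t))
    0<output = ≤-trans (subst (λ es → 0 < length es) (sym (output-run c (pre + delay)))
        (firstEdge (tree-nonempty tree isMST)))
      (output-mono c fast)
    emitted : ∀ es → ¬ es ≡ Snapshot.output (run c t)
    emitted []             eq = contradiction (subst (λ es → 0 < length es) (sym eq) 0<output) λ ()
    emitted ((u , v) ∷ es) eq with subst (All (Between (seen e))) (sym eq) (outputIn e c seen⊆)
    ... | (u∈ , v∈) ∷ _ = probed∷¬MST (seen⊆ u∈) (seen⊆ v∈) (subst (IsMST graph)
      (trans (sym (proj₂ (emitsTree t))) (cong (_++ proj₁ (emitsTree t)) (sym (trans eq (output-run c t))))) isMST)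

opaque

  -- The run of the given program is explored for `T` steps first, and the graph is chosen
  -- afterwards. The word size is known in advance, as every candidate has `k * k` vertices.
  slowInput : (I : InstructionSet) (W : ℕ → ℕ) (g : ℕ → ℚ) (P : Program I) (m T : ℕ) →
              1 + 2 * T ≤ m → (∀ Δ → T ≤ Δ → ℕ→ℚ 4 ℚ.≤ g Δ) →
              ∃ λ (x : Input g) → T ≤ Δ[ x ] × Δ[ x ] ≤ 3 * suc m × (∀ pre delay → pre + delay ≤ T →
                ¬ Enumerates I (W (Graph.n (Input.graph x))) (Input.graph x) P pre delay)
  slowInput I W g P m T 2T<m 4≤g = input , T≤Δ , maxDegree≤3k
    , λ pre delay → tooSlow I (W (k * k)) P m e c (seen⊆ ∘ there) (seen⊆ (here refl))
    where
    open Grid m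
    open Config
    open Runs I (W (k * k)) P m
    open Explored
    T≤m : T ≤ m
    T≤m = ≤-trans (m≤m+n T (T + 0)) (<⇒≤ 2T<m)
    e : Explored T
    e = explore T (m≤n⇒m≤1+n 2T<m) T≤m
    -- The vertex `at zero zero` ensures that some vertex is probed even if the program accesses
    -- none. It accounts for the 1 in `1 + 2 * T ≤ m`.
    few′ : length (at zero zero ∷ seen e) < k
    few′ = s≤s (≤-<-trans (few e) 2T<m)
    sample : ∃ λ c → probed c ≡ at zero zero ∷ seen e
    sample = config (at zero zero ∷ seen e) few′
    c : Config
    c = proj₁ sample
    seen⊆ : at zero zero ∷ seen e ⊆ probed c
    seen⊆ {v} = subst (v ∈_) (sym (proj₂ sample))
    open Instance c using (graph; connected; twoWeights; k≤maxDegree; maxDegree≤3k; sum-deg≤)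
    T≤Δ : T ≤ maxDegree graph
    T≤Δ = ≤-trans (m≤n⇒m≤1+n T≤m) (k≤maxDegree (seen⊆ (here refl)))
    input : Input g
    input = record
      { graph      = graph
      ; connected  = connected
      ; twoWeights = twoWeights (seen⊆ (here refl)) (≤-trans (s≤s z≤n) 2T<m)
      ; sparse     = ℚ.≤-trans
          (≤-/ _ (k * k) (sum-deg≤ (subst (λ vs → length vs ≤ k) (sym (proj₂ sample)) (<⇒≤ few′))))
          (4≤g (maxDegree graph) T≤Δ)
      }

noFastEnumeration : (I : InstructionSet) (W : ℕ → ℕ) (g : ℕ → ℚ) (P : Program I) (pre delay : Input g → ℕ) →
  Eventually≥ (ℕ→ℚ 4) g →
  (∃ λ N → ∀ x → N ≤ Δ[ x ] → pre x * 24 ≤ Δ[ x ]) →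
  (∃ λ N → ∀ x → N ≤ Δ[ x ] → delay x * 24 ≤ Δ[ x ]) →
  ¬ (∀ x → Enumerates I (W (Graph.n (Input.graph x))) (Input.graph x) P (pre x) (delay x))
noFastEnumeration I W g P pre delay (N₀ , 4≤g) (N₁ , pre≤) (N₂ , delay≤) enumerates =
  slow (pre x) (delay x) fast (enumerates x)
  where
  -- At least each of the three thresholds, and positive, as the estimate with the factor 24
  -- requires.
  T : ℕ
  T = suc (N₀ + (N₁ + N₂))
  N₀≤T : N₀ ≤ T
  N₀≤T = m≤n⇒m≤1+n (m≤m+n N₀ (N₁ + N₂))
  N₁≤T : N₁ ≤ T
  N₁≤T = m≤n⇒m≤1+n (≤-trans (m≤m+n N₁ N₂) (m≤n+m (N₁ + N₂) N₀))
  N₂≤T : N₂ ≤ T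
  N₂≤T = m≤n⇒m≤1+n (≤-trans (m≤n+m N₂ N₁) (m≤n+m (N₁ + N₂) N₀))
  found : ∃ λ (x : Input g) → T ≤ Δ[ x ] × Δ[ x ] ≤ 3 * (2 + 2 * T) × (∀ pre delay → pre + delay ≤ T →
            ¬ Enumerates I (W (Graph.n (Input.graph x))) (Input.graph x) P pre delay)
  -- The smallest admissible `m` keeps the maximum degree linear in `T`.
  found = slowInput I W g P (1 + 2 * T) T ≤-refl (λ Δ T≤Δ → 4≤g Δ (≤-trans N₀≤T T≤Δ))
  x : Input g
  x = proj₁ found
  T≤Δ : T ≤ Δ[ x ]
  T≤Δ = proj₁ (proj₂ found)
  Δ≤ : Δ[ x ] ≤ 3 * (2 + 2 * T)
  Δ≤ = proj₁ (proj₂ (proj₂ found))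
  slow : ∀ pre delay → pre + delay ≤ T → ¬ Enumerates I (W (Graph.n (Input.graph x))) (Input.graph x) P pre delay
  slow = proj₂ (proj₂ (proj₂ found))
  fast : pre x + delay x ≤ T
  fast = +≤-from-*24 {pre x} {delay x} (s≤s z≤n) Δ≤ (pre≤ x (≤-trans N₁≤T T≤Δ)) (delay≤ x (≤-trans N₂≤T T≤Δ))

theorem5 : ∃ λ (c : ℚ) →
    (I : InstructionSet) (W : ℕ → ℕ) → OmegaLog W →
    (g : ℕ → ℚ) → LittleO g id → Eventually≥ c g →
    ¬ ∃ λ (P : Program I) → EnumeratesInLittleOΔ I W g P
theorem5 = ℕ→ℚ 4 , λ I W _ g _ 4≤g (P , pre , delay , pre∈o , delay∈o , enumerates) →
  noFastEnumeration I W g P pre delay 4≤g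
    (littleO⇒*24≤ pre Δ[_] pre∈o) (littleO⇒*24≤ delay Δ[_] delay∈o) enumerates
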